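{- Let $K$ be a matroid, and let $N$ be a matroid whose ground set is the set of hyperplanes of $K$, such that: if $\mathcal{H}'$ is a set of hyperplanes of $K$ for which no hyperplane in $\mathcal{H}'$ contains the intersection of the others, and $r_K(\bigcap_{H\in\mathcal{H}'}H)=r(K)-|\mathcal{H}'|$, then each hyperplane $H'$ of $K$ that contains $\bigcap_{H\in\mathcal{H}'}H$ satisfies $H'\in\mathrm{cl}_N(\mathcal{H}')$. Then the function $r_{K_N}$ defined, for all $X\subseteq E(K)$, by $$r_{K_N}(X)=r_K(X)-r(N)+r_N(\{H\colon H\text{ is a hyperplane of } K \text{ that contains } X\})$$ is the rank function of a matroid $K_N$ on $E(K)$ which is a rank-$r(N)$ projection of $K$.
   Context: Matroids are finite; $\mathrm{cl}_N$ is the closure operator of $N$. The intersection of an empty collection of hyperplanes of $K$ is understood to be $E(K)$. A matroid $M$ is a projection (or quotient) of a matroid $K$ if $K$ is a lift of $M$, i.e. there is a matroid $P$ and a subset $X$ of $E(P)$ so that $P\setminus X=K$ and $P/X=M$. It is a rank-$k$ projection of $K$ if moreover $r(K)-r(M)=k$. -}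

module Defs where

open import Data.Bool.Properties as Bool using ()
open import Data.Fin using (Fin)
open import Data.Fin.Properties as Fin using (any?)
open import Data.Fin.Subset
  using (Subset; inside; outside; ⊤; ⁅_⁆; _∈_; _∉_; _⊆_; _∪_; _∩_; _-_; ∣_∣; ⋂)
open import Data.Fin.Subset.Properties using (_∈?_; _⊆?_)
open import Data.Integer as ℤ using (ℤ)
open import Data.List using (List; []; _∷_; _++_; map; filter; allFin; length; lookup)
open import Data.List.Membership.Propositional as List using ()
open import Data.List.Membership.Propositional.Properties
  using (∈-++⁺ˡ; ∈-++⁺ʳ; ∈-map⁺; ∈-map⁻; ∈-filter⁺; ∈-filter⁻)
open import Data.List.Relation.Unary.All using ([])
open import Data.List.Relation.Unary.AllPairs using ([]; _∷_)
open import Data.List.Relation.Unary.Any using (here)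
open import Data.List.Relation.Unary.Unique.Propositional using (Unique)
open import Data.List.Relation.Unary.Unique.Propositional.Properties using (map⁺; ++⁺; filter⁺)
open import Data.Nat using (ℕ; zero; suc; _+_; _∸_; _≤_; _≟_)
open import Data.Product using (Σ-syntax; ∃-syntax; _×_; _,_; proj₂)
open import Data.Vec using ([]; _∷_; tabulate)
open import Data.Vec.Properties using (≡-dec; ∷-injectiveʳ)
open import Function using (_∘_; _⇔_; mk⇔; Injective)
open import Relation.Binary.PropositionalEquality using (_≡_; refl; trans; sym)
open import Relation.Nullary using (Dec; does; ¬_; _×-dec_)
open import Relation.Unary using (Decidable)

select : ∀ {n} {P : Fin n → Set} → Decidable P → Subset n
select P? = tabulate (does ∘ P?)

-- Finite matroids, given by their rank functions; the ground set is Fin n.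
record Matroid (n : ℕ) : Set where
  field
    rank            : Subset n → ℕ
    rank-bounded    : ∀ X → rank X ≤ ∣ X ∣
    rank-mono       : ∀ X Y → X ⊆ Y → rank X ≤ rank Y
    rank-submodular : ∀ X Y → rank (X ∪ Y) + rank (X ∩ Y) ≤ rank X + rank Y

open Matroid public using (rank)

r : ∀ {n} → Matroid n → ℕ
r M = rank M ⊤

cl : ∀ {n} → Matroid n → Subset n → Subset n
cl M X = select (λ e → rank M (X ∪ ⁅ e ⁆) ≟ rank M X)

IsFlat : ∀ {n} → Matroid n → Subset n → Set
IsFlat M F = cl M F ≡ F

IsHyperplane : ∀ {n} → Matroid n → Subset n → Set
IsHyperplane M H = IsFlat M H × suc (rank M H) ≡ r M

isHyperplane? : ∀ {n} (M : Matroid n) → Decidable (IsHyperplane M)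
isHyperplane? M H = ≡-dec Bool._≟_ (cl M H) H ×-dec (suc (rank M H) ≟ r M)

subsets : ∀ n → List (Subset n)
subsets zero    = [] ∷ []
subsets (suc n) = map (outside ∷_) (subsets n) ++ map (inside ∷_) (subsets n)

hyperplanes : ∀ {n} → Matroid n → List (Subset n)
hyperplanes {n} M = filter (isHyperplane? M) (subsets n)

subsets-complete : ∀ {n} (X : Subset n) → X List.∈ subsets n
subsets-complete []            = here refl
subsets-complete (outside ∷ X) = ∈-++⁺ˡ (∈-map⁺ (outside ∷_) (subsets-complete X))
subsets-complete (inside ∷ X)  = ∈-++⁺ʳ _ (∈-map⁺ (inside ∷_) (subsets-complete X))

subsets-unique : ∀ n → Unique (subsets n)
subsets-unique zero    = [] ∷ []
subsets-unique (suc n) =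
  ++⁺ (map⁺ ∷-injectiveʳ (subsets-unique n)) (map⁺ ∷-injectiveʳ (subsets-unique n)) disjoint
  where
  disjoint : ∀ {X} →
             ¬ (X List.∈ map (outside ∷_) (subsets n) × X List.∈ map (inside ∷_) (subsets n))
  disjoint (p , q) with ∈-map⁻ (outside ∷_) p | ∈-map⁻ (inside ∷_) q
  ... | _ , _ , e | _ , _ , f with trans (sym e) f
  ... | ()

∈-hyperplanes : ∀ {n} (M : Matroid n) H → H List.∈ hyperplanes M ⇔ IsHyperplane M H
∈-hyperplanes {n} M H =
  mk⇔ (λ p → proj₂ (∈-filter⁻ (isHyperplane? M) {xs = subsets n} p))
      (∈-filter⁺ (isHyperplane? M) (subsets-complete H))

hyperplanes-unique : ∀ {n} (M : Matroid n) → Unique (hyperplanes M)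
hyperplanes-unique {n} M = filter⁺ (isHyperplane? M) (subsets-unique n)

-- The set of hyperplanes of M is represented by the positions in the
-- duplicate-free list of all of them, so a matroid on this set is a matroid
-- on Fin (#hyperplanes M), and a set of hyperplanes is a Subset (#hyperplanes M).
#hyperplanes : ∀ {n} → Matroid n → ℕ
#hyperplanes M = length (hyperplanes M)

hyperplane : ∀ {n} (M : Matroid n) → Fin (#hyperplanes M) → Subset n
hyperplane M = lookup (hyperplanes M)

-- ⋂ of the empty list is ⊤, the whole ground set.
intersection : ∀ {n} (M : Matroid n) → Subset (#hyperplanes M) → Subset n
intersection M 𝓗 = ⋂ (map (hyperplane M) (filter (_∈? 𝓗) (allFin _)))

hyperplanesContaining : ∀ {n} (M : Matroid n) → Subset n → Subset (#hyperplanes M)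
hyperplanesContaining M X = select (λ i → X ⊆? hyperplane M i)

NoneContainsIntersectionOfOthers : ∀ {n} (M : Matroid n) → Subset (#hyperplanes M) → Set
NoneContainsIntersectionOfOthers M 𝓗 =
  ∀ i → i ∈ 𝓗 → ¬ (intersection M (𝓗 - i) ⊆ hyperplane M i)

image : ∀ {m n} → (Fin n → Fin m) → Subset n → Subset m
image e Y = select (λ j → any? (λ i → (i ∈? Y) ×-dec (e i Fin.≟ j)))

-- The map e names the elements of E(P) − X by the elements of Fin n; the next
-- two definitions state P∖X = K and P/X = M under this naming.  The
-- subtraction in the second does not truncate, since rank P is monotone.
Labels : ∀ {m n} → Subset m → (Fin n → Fin m) → Set
Labels X e = Injective _≡_ _≡_ e × (∀ j → j ∉ X ⇔ (∃[ i ] e i ≡ j))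

IsDeletion : ∀ {m n} → Matroid m → (Fin n → Fin m) → Matroid n → Set
IsDeletion P e K = ∀ Y → rank K Y ≡ rank P (image e Y)

IsContraction : ∀ {m n} → Matroid m → Subset m → (Fin n → Fin m) → Matroid n → Set
IsContraction P X e M = ∀ Y → rank M Y ≡ rank P (image e Y ∪ X) ∸ rank P X

IsLift : ∀ {n} → Matroid n → Matroid n → Set
IsLift {n} K M =
  ∃[ m ] Σ[ P ∈ Matroid m ] Σ[ X ∈ Subset m ] Σ[ e ∈ (Fin n → Fin m) ]
    Labels X e × IsDeletion P e K × IsContraction P X e M

IsProjection : ∀ {n} → Matroid n → Matroid n → Set
IsProjection M K = IsLift K M

IsRankProjection : ∀ {n} → ℕ → Matroid n → Matroid n → Set
IsRankProjection k M K = IsProjection M K × ℤ.+ r K ℤ.- ℤ.+ r M ≡ ℤ.+ k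

rankKN : ∀ {n} (K : Matroid n) → Matroid (#hyperplanes K) → Subset n → ℤ
rankKN K N X =
  ℤ.+ rank K X ℤ.- ℤ.+ r N ℤ.+ ℤ.+ rank N (hyperplanesContaining K X)

{-# OPTIONS --safe #-}
module Submission where

-- Suppose Z ∪ B spans K and r(Z) + |B| = r(K), and for x in B let H_x be the
-- hyperplane cl(Z ∪ (B − x)).  If B is the disjoint union of I and A, then the
-- family {H_x : x ∈ A} satisfies the hypothesis of the theorem and its members
-- intersect in cl(Z ∪ I), so it spans in N all hyperplanes containing Z ∪ I.
-- Thus s(Z ∪ I) = r_N{H_x : x ∈ A}, where s(X) is the N-rank of the set of
-- hyperplanes containing X, and properties of r_N transfer to s.  Subadditivity
-- makes r_K + s monotone.  For submodularity at X, Y take Z = X ∩ Y, a basis I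
-- of X over Z, a set J ⊆ Y completing it to a basis of X ∪ Y, and a set L
-- completing it further to one of K: submodularity of r_N at the families
-- indexed by J ∪ L and I ∪ L settles Z ∪ I and Z ∪ J, and monotonicity replaces
-- these sets by X and Y.
--
-- Since s is antitone, r_K − r_{K_N} = r(N) − s is monotone.  A matroid M such
-- that r_K − r_M is monotone with maximum k is a projection of K: on E together
-- with k new elements, min(r_K(X) + |Z|, r_M(X) + k) is the rank of X ∪ Z in a
-- matroid whose deletion and contraction of the new elements are K and M.

open import Defs
open import Data.Fin.Subset using (Subset; _∈_; _⊆_; ∣_∣)
open import Data.Nat using (ℕ)
open import Data.Product using (Σ-syntax; _×_)
open import Relation.Binary.PropositionalEquality using (_≡_)

import Data.Bool.Properties as Bool
open import Data.Empty using (⊥-elim)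
open import Data.Fin using (Fin; zero; suc; _↑ˡ_; _↑ʳ_)
import Data.Fin.Properties as Fin
import Data.Integer as ℤ
import Data.Integer.Properties as ℤ
open import Data.Fin.Subset as Subset using (inside; outside; ⊥; ⊤; ⁅_⁆; _∉_; _∪_; _∩_; ⋂)
open import Data.Fin.Subset.Properties
open import Data.List using (List; []; _∷_; filter; allFin; lookup)
open import Data.List.Membership.Propositional.Properties
  using (∈-lookup; ∈-map⁺; ∈-filter⁺; ∈-filter⁻; ∈-allFin)
open import Data.List.Relation.Unary.All as All using (All; []; _∷_)
import Data.List.Relation.Unary.All.Properties as All
open import Data.List.Relation.Unary.AllPairs using (_∷_)
open import Data.List.Relation.Unary.Any using (index)
open import Data.List.Relation.Unary.Any.Properties using (lookup-index)
open import Data.List.Relation.Unary.Unique.Propositional using (Unique)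
open import Data.Nat using (zero; suc; _+_; _∸_; _⊓_; _≤_; _<_; s≤s; z≤n; _≤?_)
open import Data.Nat.Properties
open import Data.Nat.Tactic.RingSolver using (solve-∀)
open import Data.Product using (∃-syntax; _,_; proj₁; proj₂)
open import Data.Sum using (inj₁; inj₂; [_,_]′)
open import Data.Vec using ([]; _∷_; here; there; take; drop)
open import Data.Vec.Properties using (≡-dec; []=⇒lookup; lookup⇒[]=; lookup∘tabulate; take-zipWith; drop-zipWith)
open import Function using (_∘_; Equivalence; mk⇔)
open import Relation.Binary.PropositionalEquality using (_≢_; refl; sym; trans; cong; cong₂; subst; subst₂; module ≡-Reasoning)
open import Relation.Nullary using (yes; no; does; _×-dec_; contradiction)
open import Relation.Nullary.Decidable using (dec-true)
open import Relation.Unary using (Decidable)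

private
  variable
    m n : ℕ

-- Finite subsets: membership, cardinality and induction.

∈-select⁺ : {P : Fin n → Set} (P? : Decidable P) {i : Fin n} → P i → i ∈ select P?
∈-select⁺ P? {i} p = lookup⇒[]= i _ (trans (lookup∘tabulate _ i) (dec-true (P? i) p))

∈-select⁻ : {P : Fin n → Set} (P? : Decidable P) {i : Fin n} → i ∈ select P? → P i
∈-select⁻ P? {i} i∈ with P? i | trans (sym (lookup∘tabulate (does ∘ P?) i)) ([]=⇒lookup i∈)
... | yes p | _ = p
... | no _  | ()

⊆-∪ˡ : {p q r : Subset n} → p ⊆ q → p ⊆ q ∪ r
⊆-∪ˡ p⊆q = p⊆p∪q _ ∘ p⊆q

⊆-∪ʳ : {p q r : Subset n} → p ⊆ r → p ⊆ q ∪ r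
⊆-∪ʳ p⊆r = q⊆p∪q _ _ ∘ p⊆r

∪-lub : {p q r : Subset n} → p ⊆ r → q ⊆ r → p ∪ q ⊆ r
∪-lub p⊆r q⊆r x∈ = [ p⊆r , q⊆r ]′ (x∈p∪q⁻ _ _ x∈)

∪-mono : {p p′ q q′ : Subset n} → p ⊆ p′ → q ⊆ q′ → p ∪ q ⊆ p′ ∪ q′
∪-mono p⊆p′ q⊆q′ = ∪-lub (⊆-∪ˡ p⊆p′) (⊆-∪ʳ q⊆q′)

⁅⁆⊆ : {x : Fin n} {p : Subset n} → x ∈ p → ⁅ x ⁆ ⊆ p
⁅⁆⊆ {x = x} x∈p y∈ = subst (_∈ _) (sym (x∈⁅y⁆⇒x≡y x y∈)) x∈p

x∉p-x : (p : Subset n) (x : Fin n) → x ∉ p Subset.- x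
x∉p-x (_ ∷ _) zero    ()
x∉p-x (_ ∷ p) (suc x) (there x∈) = x∉p-x p x x∈

p⊆p-x∪⁅x⁆ : (p : Subset n) (x : Fin n) → p ⊆ (p Subset.- x) ∪ ⁅ x ⁆
p⊆p-x∪⁅x⁆ p x {y} y∈p with y Fin.≟ x
... | yes refl = x∈p∪q⁺ (inj₂ (x∈⁅x⁆ x))
... | no y≢x   = x∈p∪q⁺ (inj₁ (x∈p∧x≢y⇒x∈p-y y∈p y≢x))

∣p∪q∣+∣p∩q∣≡∣p∣+∣q∣ : (p q : Subset n) → ∣ p ∪ q ∣ + ∣ p ∩ q ∣ ≡ ∣ p ∣ + ∣ q ∣
∣p∪q∣+∣p∩q∣≡∣p∣+∣q∣ []            []            = refl
∣p∪q∣+∣p∩q∣≡∣p∣+∣q∣ (outside ∷ p) (outside ∷ q) = ∣p∪q∣+∣p∩q∣≡∣p∣+∣q∣ p q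
∣p∪q∣+∣p∩q∣≡∣p∣+∣q∣ (outside ∷ p) (inside ∷ q)  =
  trans (cong suc (∣p∪q∣+∣p∩q∣≡∣p∣+∣q∣ p q)) (sym (+-suc ∣ p ∣ ∣ q ∣))
∣p∪q∣+∣p∩q∣≡∣p∣+∣q∣ (inside ∷ p)  (outside ∷ q) = cong suc (∣p∪q∣+∣p∩q∣≡∣p∣+∣q∣ p q)
∣p∪q∣+∣p∩q∣≡∣p∣+∣q∣ (inside ∷ p)  (inside ∷ q)  =
  cong suc (trans (+-suc ∣ p ∪ q ∣ ∣ p ∩ q ∣)
    (trans (cong suc (∣p∪q∣+∣p∩q∣≡∣p∣+∣q∣ p q)) (sym (+-suc ∣ p ∣ ∣ q ∣))))

∣p∪q∣≤∣p∣+∣q∣ : (p q : Subset n) → ∣ p ∪ q ∣ ≤ ∣ p ∣ + ∣ q ∣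
∣p∪q∣≤∣p∣+∣q∣ p q = ≤-trans (m≤m+n _ _) (≤-reflexive (∣p∪q∣+∣p∩q∣≡∣p∣+∣q∣ p q))

∣p∪⁅x⁆∣≤1+∣p∣ : (p : Subset n) (x : Fin n) → ∣ p ∪ ⁅ x ⁆ ∣ ≤ suc ∣ p ∣
∣p∪⁅x⁆∣≤1+∣p∣ p x = begin
  ∣ p ∪ ⁅ x ⁆ ∣     ≤⟨ ∣p∪q∣≤∣p∣+∣q∣ p ⁅ x ⁆ ⟩
  ∣ p ∣ + ∣ ⁅ x ⁆ ∣ ≡⟨ cong (∣ p ∣ +_) (∣⁅x⁆∣≡1 x) ⟩
  ∣ p ∣ + 1         ≡⟨ +-comm ∣ p ∣ 1 ⟩
  suc ∣ p ∣         ∎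
  where open ≤-Reasoning

-- Recursion on the ground set: the elements other than `zero` are added first, and `zero` last if
-- it is present.
subset-induction : (P : Subset n → Set) → P ⊥ →
                   (∀ p x → x ∉ p → P p → P (p ∪ ⁅ x ⁆)) → ∀ p → P p
subset-induction {zero}  P base step []            = base
subset-induction {suc n} P base step (s ∷ p)       = cons s
  where
  tail : P (outside ∷ p)
  tail = subset-induction (P ∘ (outside ∷_)) base
    (λ q x x∉q → step (outside ∷ q) (suc x) (x∉q ∘ drop-there)) p
  cons : ∀ s → P (s ∷ p)
  cons outside = tail
  cons inside  = subst (λ q → P (inside ∷ q)) (∪-identityʳ p) (step (outside ∷ p) zero (λ ()) tail)

-- Pigeonhole: a partner `y` of the first element is removed from `q`, and injectivity keeps the
-- partners of the other elements in what remains. A relation lets the count run both ways between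
-- elements and hyperplanes.
∣∣-≤-relation : (R : Fin m → Fin n → Set) (p : Subset m) (q : Subset n) →
                (∀ {x} → x ∈ p → ∃[ y ] (y ∈ q × R x y)) →
                (∀ {x x′ y} → x ∈ p → x′ ∈ p → R x y → R x′ y → x ≡ x′) →
                ∣ p ∣ ≤ ∣ q ∣
∣∣-≤-relation R []            q total injective = z≤n
∣∣-≤-relation R (outside ∷ p) q total injective =
  ∣∣-≤-relation (R ∘ suc) p q (total ∘ there)
    (λ x∈ x′∈ Rxy Rx′y → Fin.suc-injective (injective (there x∈) (there x′∈) Rxy Rx′y))
∣∣-≤-relation R (inside ∷ p)  q total injective with total here
... | y , y∈q , R0y = ≤-trans (s≤s shorter) (x∈p⇒∣p-x∣<∣p∣ y∈q)
  where
  total′ : ∀ {x} → x ∈ p → ∃[ y′ ] (y′ ∈ q Subset.- y × R (suc x) y′)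
  total′ x∈p with total (there x∈p)
  ... | y′ , y′∈q , Rxy′ = y′ , x∈p∧x≢y⇒x∈p-y y′∈q y′≢y , Rxy′
    where
    y′≢y : y′ ≢ y
    y′≢y refl with injective here (there x∈p) R0y Rxy′
    ... | ()
  shorter : ∣ p ∣ ≤ ∣ q Subset.- y ∣
  shorter = ∣∣-≤-relation (R ∘ suc) p (q Subset.- y) total′
    (λ x∈ x′∈ Rxy Rx′y → Fin.suc-injective (injective (there x∈) (there x′∈) Rxy Rx′y))

∈-⋂⁺ : {x : Fin n} {ps : List (Subset n)} → All (x ∈_) ps → x ∈ ⋂ ps
∈-⋂⁺ []             = ∈⊤
∈-⋂⁺ (x∈p ∷ x∈ps) = x∈p∩q⁺ (x∈p , ∈-⋂⁺ x∈ps)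

∈-⋂⁻ : {x : Fin n} (ps : List (Subset n)) → x ∈ ⋂ ps → All (x ∈_) ps
∈-⋂⁻ []       _   = []
∈-⋂⁻ (p ∷ ps) x∈ with x∈p∩q⁻ p (⋂ ps) x∈
... | x∈p , x∈ps = x∈p ∷ ∈-⋂⁻ ps x∈ps

Unique⇒lookup-injective : {A : Set} {xs : List A} → Unique xs → ∀ i j →
                          lookup xs i ≡ lookup xs j → i ≡ j
Unique⇒lookup-injective (_ ∷ _)    zero    zero    _  = refl
Unique⇒lookup-injective (x≢ ∷ _)   zero    (suc j) eq =
  contradiction eq (All.lookup x≢ (∈-lookup j))
Unique⇒lookup-injective (x≢ ∷ _)   (suc i) zero    eq =
  contradiction (sym eq) (All.lookup x≢ (∈-lookup i))
Unique⇒lookup-injective (_ ∷ uniq) (suc i) (suc j) eq =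
  cong suc (Unique⇒lookup-injective uniq i j eq)

-- Rank, closure, flats and hyperplanes of a matroid.

module _ (M : Matroid n) where

  open Matroid M using (rank-bounded; rank-mono; rank-submodular)

  rank-⊥ : rank M ⊥ ≡ 0
  rank-⊥ = n≤0⇒n≡0 (subst (rank M ⊥ ≤_) (∣⊥∣≡0 n) (rank-bounded ⊥))

  rank-⊆ : ∀ {X Y} → X ⊆ Y → rank M X ≤ rank M Y
  rank-⊆ = rank-mono _ _

  -- Submodularity combined with monotonicity, so that later uses need only inclusions and no
  -- identities between sets.
  rank-submodular-⊆ : ∀ {X Y C D} → C ⊆ X → C ⊆ Y → D ⊆ X ∪ Y →
                      rank M D + rank M C ≤ rank M X + rank M Y
  rank-submodular-⊆ {X} {Y} C⊆X C⊆Y D⊆X∪Y =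
    ≤-trans (+-mono-≤ (rank-⊆ D⊆X∪Y) (rank-⊆ λ x∈C → x∈p∩q⁺ (C⊆X x∈C , C⊆Y x∈C)))
            (rank-submodular X Y)

  rank-∪ : ∀ X Y → rank M (X ∪ Y) ≤ rank M X + rank M Y
  rank-∪ X Y = ≤-trans (m≤m+n _ _) (rank-submodular X Y)

  rank-∪-∣∣ : ∀ X Y → rank M (X ∪ Y) ≤ rank M X + ∣ Y ∣
  rank-∪-∣∣ X Y = ≤-trans (rank-∪ X Y) (+-monoʳ-≤ _ (rank-bounded Y))

  rank-∪-⁅⁆ : ∀ X x → rank M (X ∪ ⁅ x ⁆) ≤ suc (rank M X)
  rank-∪-⁅⁆ X x = begin
    rank M (X ∪ ⁅ x ⁆)     ≤⟨ rank-∪-∣∣ X ⁅ x ⁆ ⟩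
    rank M X + ∣ ⁅ x ⁆ ∣   ≡⟨ cong (rank M X +_) (∣⁅x⁆∣≡1 x) ⟩
    rank M X + 1           ≡⟨ +-comm _ 1 ⟩
    suc (rank M X)         ∎
    where open ≤-Reasoning

  -- Submodularity at `Y` and `X ∪ Z`, which share `X` and together cover `Y ∪ Z`.
  rank-∪-diminishing : ∀ {X Y} Z → X ⊆ Y → rank M Y ≤ rank M X →
                       rank M (Y ∪ Z) ≤ rank M (X ∪ Z)
  rank-∪-diminishing {X} {Y} Z X⊆Y rY≤rX = +-cancelʳ-≤ (rank M X) _ _ (begin
    rank M (Y ∪ Z) + rank M X ≤⟨ rank-submodular-⊆ X⊆Y (⊆-∪ˡ ⊆-refl) (∪-mono ⊆-refl (⊆-∪ʳ ⊆-refl)) ⟩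
    rank M Y + rank M (X ∪ Z) ≤⟨ +-monoˡ-≤ _ rY≤rX ⟩
    rank M X + rank M (X ∪ Z) ≡⟨ +-comm (rank M X) _ ⟩
    rank M (X ∪ Z) + rank M X ∎)
    where open ≤-Reasoning

  ∈-cl⁺ : ∀ {X e} → rank M (X ∪ ⁅ e ⁆) ≤ rank M X → e ∈ cl M X
  ∈-cl⁺ {X} le = ∈-select⁺ (λ e → rank M (X ∪ ⁅ e ⁆) ≟ rank M X) (≤-antisym le (rank-⊆ (⊆-∪ˡ ⊆-refl)))

  ∈-cl⁻ : ∀ {X e} → e ∈ cl M X → rank M (X ∪ ⁅ e ⁆) ≤ rank M X
  ∈-cl⁻ {X} e∈ = ≤-reflexive (∈-select⁻ (λ e → rank M (X ∪ ⁅ e ⁆) ≟ rank M X) e∈)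

  -- Elements are added singly: `X ∪ Y` and `X ∪ ⁅ x ⁆` share `X`, and neither exceeds its rank.
  rank-∪-⊆cl : ∀ X Y → Y ⊆ cl M X → rank M (X ∪ Y) ≤ rank M X
  rank-∪-⊆cl X = subset-induction (λ Y → Y ⊆ cl M X → rank M (X ∪ Y) ≤ rank M X)
    (λ _ → rank-⊆ (∪-lub ⊆-refl ⊥⊆))
    (λ Y x _ ih Y∪x⊆ → +-cancelʳ-≤ (rank M X) _ _ (≤-trans
      (rank-submodular-⊆ (⊆-∪ˡ ⊆-refl) (⊆-∪ˡ ⊆-refl)
        (∪-lub (⊆-∪ˡ (⊆-∪ˡ ⊆-refl)) (∪-mono (⊆-∪ʳ ⊆-refl) (⊆-∪ʳ ⊆-refl))))
      (+-mono-≤ (ih (Y∪x⊆ ∘ p⊆p∪q _)) (∈-cl⁻ (Y∪x⊆ (q⊆p∪q Y _ (x∈⁅x⁆ x)))))))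

  rank-⊆cl : ∀ {X Y} → Y ⊆ cl M X → rank M Y ≤ rank M X
  rank-⊆cl {X} {Y} Y⊆ = ≤-trans (rank-⊆ (⊆-∪ʳ ⊆-refl)) (rank-∪-⊆cl X Y Y⊆)

  ⊆-cl : ∀ {X} → X ⊆ cl M X
  ⊆-cl x∈X = ∈-cl⁺ (rank-⊆ (∪-lub ⊆-refl (⁅⁆⊆ x∈X)))

  cl-mono : ∀ {X Y} → X ⊆ Y → cl M X ⊆ cl M Y
  cl-mono {X} {Y} X⊆Y {e} e∈ = ∈-cl⁺ (+-cancelʳ-≤ (rank M X) _ _ (≤-trans
    (rank-submodular-⊆ X⊆Y (⊆-∪ˡ ⊆-refl) (∪-mono ⊆-refl (⊆-∪ʳ ⊆-refl)))
    (+-monoʳ-≤ (rank M Y) (∈-cl⁻ e∈))))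

  cl-isFlat : ∀ X → IsFlat M (cl M X)
  cl-isFlat X = ⊆-antisym
    (λ e∈ → ∈-cl⁺ (≤-trans (rank-⊆ (∪-mono ⊆-cl ⊆-refl)) (≤-trans (∈-cl⁻ e∈) (rank-⊆cl ⊆-refl))))
    ⊆-cl

  -- Adding an element of `Y` to `X` cannot raise the rank, so `Y` lies in the closure of `X`, hence
  -- in that of the flat `F`.
  flat-⊇ : ∀ {F X Y} → IsFlat M F → X ⊆ F → X ⊆ Y → rank M Y ≤ rank M X → Y ⊆ F
  flat-⊇ flat X⊆F X⊆Y rY≤rX y∈Y = subst (_ ∈_) flat
    (cl-mono X⊆F (∈-cl⁺ (≤-trans (rank-⊆ (∪-lub X⊆Y (⁅⁆⊆ y∈Y))) rY≤rX)))

  rank-∪-∉flat : ∀ {F X e} → IsFlat M F → X ⊆ F → e ∉ F → rank M X < rank M (X ∪ ⁅ e ⁆)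
  rank-∪-∉flat {F} {X} {e} flat X⊆F e∉F = ≰⇒>
    (λ le → e∉F (flat-⊇ flat X⊆F (⊆-∪ˡ ⊆-refl) le (q⊆p∪q X _ (x∈⁅x⁆ e))))

  -- The set `I` is a basis of `Y` in the contraction of `X`: the first inequality says that it
  -- spans, the second that it is independent. It is built greedily, keeping an element only if it
  -- raises the rank.
  augmentation : ∀ X Y → ∃[ I ] (I ⊆ Y × (∀ {x} → x ∈ I → x ∉ X) ×
                                 rank M (X ∪ Y) ≤ rank M (X ∪ I) ×
                                 rank M X + ∣ I ∣ ≤ rank M (X ∪ I))
  augmentation X = subset-induction Augmentation base step
    where
    Augmentation : Subset n → Set
    Augmentation Y = ∃[ I ] (I ⊆ Y × (∀ {x} → x ∈ I → x ∉ X) ×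
                             rank M (X ∪ Y) ≤ rank M (X ∪ I) ×
                             rank M X + ∣ I ∣ ≤ rank M (X ∪ I))
    base : Augmentation ⊥
    base = ⊥ , (λ x∈⊥ → x∈⊥) , (λ x∈⊥ → ⊥-elim (∉⊥ x∈⊥)) , ≤-refl ,
      ≤-trans (≤-reflexive (trans (cong (_ +_) (∣⊥∣≡0 n)) (+-identityʳ _))) (rank-⊆ (⊆-∪ˡ ⊆-refl))
    step : ∀ Y y → y ∉ Y → Augmentation Y → Augmentation (Y ∪ ⁅ y ⁆)
    step Y y _ (I , I⊆Y , I∥X , spans , indep) with rank M (X ∪ (Y ∪ ⁅ y ⁆)) ≤? rank M (X ∪ I)
    ... | yes le = I , ⊆-∪ˡ I⊆Y , I∥X , le , indep
    ... | no gt  = I ∪ ⁅ y ⁆ , ∪-mono I⊆Y ⊆-refl , disjoint , spans′ , indep′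
      where
      disjoint : ∀ {x} → x ∈ I ∪ ⁅ y ⁆ → x ∉ X
      disjoint x∈ x∈X with x∈p∪q⁻ I _ x∈
      ... | inj₁ x∈I = I∥X x∈I x∈X
      ... | inj₂ x∈y with x∈⁅y⁆⇒x≡y y x∈y
      -- An element already in `X` would not raise the rank, contradicting `gt`.
      ...   | refl = gt (≤-trans (rank-⊆ (∪-lub (⊆-∪ˡ ⊆-refl) (∪-lub (⊆-∪ʳ ⊆-refl) (⊆-∪ˡ (⁅⁆⊆ x∈X))))) spans)
      spans′ : rank M (X ∪ (Y ∪ ⁅ y ⁆)) ≤ rank M (X ∪ (I ∪ ⁅ y ⁆))
      spans′ = begin
        rank M (X ∪ (Y ∪ ⁅ y ⁆)) ≡⟨ cong (rank M) (∪-assoc X Y ⁅ y ⁆) ⟨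
        rank M ((X ∪ Y) ∪ ⁅ y ⁆) ≤⟨ rank-∪-diminishing ⁅ y ⁆ (∪-mono ⊆-refl I⊆Y) spans ⟩
        rank M ((X ∪ I) ∪ ⁅ y ⁆) ≡⟨ cong (rank M) (∪-assoc X I ⁅ y ⁆) ⟩
        rank M (X ∪ (I ∪ ⁅ y ⁆)) ∎
        where open ≤-Reasoning
      indep′ : rank M X + ∣ I ∪ ⁅ y ⁆ ∣ ≤ rank M (X ∪ (I ∪ ⁅ y ⁆))
      indep′ = begin
        rank M X + ∣ I ∪ ⁅ y ⁆ ∣   ≤⟨ +-monoʳ-≤ _ (∣p∪⁅x⁆∣≤1+∣p∣ I y) ⟩
        rank M X + suc ∣ I ∣       ≡⟨ +-suc _ _ ⟩
        suc (rank M X + ∣ I ∣)     ≤⟨ s≤s indep ⟩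
        suc (rank M (X ∪ I))       ≤⟨ ≰⇒> gt ⟩
        rank M (X ∪ (Y ∪ ⁅ y ⁆))   ≤⟨ spans′ ⟩
        rank M (X ∪ (I ∪ ⁅ y ⁆))   ∎
        where open ≤-Reasoning

  hyperplane-isHyperplane : ∀ j → IsHyperplane M (hyperplane M j)
  hyperplane-isHyperplane j = Equivalence.to (∈-hyperplanes M _) (∈-lookup j)

  hyperplane-surjective : ∀ {H} → IsHyperplane M H → ∃[ j ] hyperplane M j ≡ H
  hyperplane-surjective isH = index H∈ , sym (lookup-index H∈)
    where H∈ = Equivalence.from (∈-hyperplanes M _) isH

  hyperplane-injective : ∀ {i j} → hyperplane M i ≡ hyperplane M j → i ≡ j
  hyperplane-injective = Unique⇒lookup-injective (hyperplanes-unique M) _ _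

  ∈-intersection⁺ : ∀ {𝓗 x} → (∀ {j} → j ∈ 𝓗 → x ∈ hyperplane M j) → x ∈ intersection M 𝓗
  ∈-intersection⁺ {𝓗} h = ∈-⋂⁺ (All.map⁺ (All.tabulate
    (λ j∈ → h (proj₂ (∈-filter⁻ (_∈? 𝓗) {xs = allFin _} j∈)))))

  ∈-intersection⁻ : ∀ {𝓗 x j} → x ∈ intersection M 𝓗 → j ∈ 𝓗 → x ∈ hyperplane M j
  ∈-intersection⁻ {𝓗} {j = j} x∈ j∈ = All.lookup (∈-⋂⁻ _ x∈)
    (∈-map⁺ (hyperplane M) (∈-filter⁺ (_∈? 𝓗) (∈-allFin j) j∈))

-- Hyperplanes opposite the elements of a basis of the contraction by Z.

module CobasisHyperplanes (K : Matroid n) (Z B : Subset n)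
  (spanning : r K ≤ rank K (Z ∪ B)) (independent : rank K Z + ∣ B ∣ ≤ r K) where

  -- For `x` in `B` this is the only hyperplane containing `Z` and all of `B` except `x`, since `B`
  -- is a basis of the contraction of `Z`.
  opposite : Fin n → Subset n
  opposite x = cl K (Z ∪ (B Subset.- x))

  opposite? : ∀ A → Decidable (λ j → ∃[ x ] (x ∈ A × hyperplane K j ≡ opposite x))
  opposite? A j = Fin.any? (λ x → (x ∈? A) ×-dec ≡-dec Bool._≟_ (hyperplane K j) (opposite x))

  oppositeHyperplanes : Subset n → Subset (#hyperplanes K)
  oppositeHyperplanes A = select (opposite? A)

  ∈-opposite : ∀ {x y} → y ∈ B → y ≢ x → y ∈ opposite x
  ∈-opposite y∈B y≢x = ⊆-cl K (q⊆p∪q Z _ (x∈p∧x≢y⇒x∈p-y y∈B y≢x))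

  rank-opposite< : ∀ {x} → x ∈ B → rank K (opposite x) < r K
  rank-opposite< {x} x∈B = begin-strict
    rank K (opposite x)             ≤⟨ rank-⊆cl K ⊆-refl ⟩
    rank K (Z ∪ (B Subset.- x))     ≤⟨ rank-∪-∣∣ K Z _ ⟩
    rank K Z + ∣ B Subset.- x ∣     <⟨ +-monoʳ-< (rank K Z) (x∈p⇒∣p-x∣<∣p∣ x∈B) ⟩
    rank K Z + ∣ B ∣                ≤⟨ independent ⟩
    r K                             ∎
    where open ≤-Reasoning

  spanning-opposite : ∀ x → r K ≤ rank K (opposite x ∪ ⁅ x ⁆)
  spanning-opposite x = ≤-trans spanning (rank-⊆ K
    (∪-lub (⊆-∪ˡ (⊆-trans (⊆-∪ˡ ⊆-refl) (⊆-cl K)))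
           (⊆-trans (p⊆p-x∪⁅x⁆ B x) (∪-mono (⊆-trans (⊆-∪ʳ ⊆-refl) (⊆-cl K)) ⊆-refl))))

  ∉-opposite : ∀ {x} → x ∈ B → x ∉ opposite x
  ∉-opposite {x} x∈B x∈ = <⇒≱ (rank-opposite< x∈B)
    (≤-trans (spanning-opposite x) (rank-⊆ K (∪-lub ⊆-refl (⁅⁆⊆ x∈))))

  opposite-isHyperplane : ∀ {x} → x ∈ B → IsHyperplane K (opposite x)
  opposite-isHyperplane {x} x∈B = cl-isFlat K _ , ≤-antisym (rank-opposite< x∈B)
    (≤-trans (spanning-opposite x) (rank-∪-⁅⁆ K _ x))

  -- The element `x` avoids its own opposite hyperplane but lies in that of every other element of
  -- `B`.
  opposite-injective : ∀ {x y} → x ∈ B → y ∈ B → opposite x ≡ opposite y → x ≡ y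
  opposite-injective {x} {y} x∈B y∈B eq with x Fin.≟ y
  ... | yes x≡y = x≡y
  ... | no x≢y  = contradiction (subst (x ∈_) (sym eq) (∈-opposite x∈B x≢y)) (∉-opposite x∈B)

  ∣oppositeHyperplanes∣≤ : ∀ A → ∣ oppositeHyperplanes A ∣ ≤ ∣ A ∣
  ∣oppositeHyperplanes∣≤ A = ∣∣-≤-relation (λ j x → hyperplane K j ≡ opposite x) _ A
    (λ j∈ → ∈-select⁻ (opposite? A) j∈)
    (λ _ _ eq eq′ → hyperplane-injective K (trans eq (sym eq′)))

  ∣∣≤oppositeHyperplanes : ∀ {A} → A ⊆ B → ∣ A ∣ ≤ ∣ oppositeHyperplanes A ∣
  ∣∣≤oppositeHyperplanes {A} A⊆B = ∣∣-≤-relation (λ x j → hyperplane K j ≡ opposite x) A _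
    (λ {x} x∈A → let j , eq = hyperplane-surjective K (opposite-isHyperplane (A⊆B x∈A)) in
      j , ∈-select⁺ (opposite? A) (x , x∈A , eq) , eq)
    (λ x∈ x′∈ eq eq′ → opposite-injective (A⊆B x∈) (A⊆B x′∈) (trans (sym eq) eq′))

  oppositeHyperplanes-∪ : ∀ {A C D} → A ⊆ C ∪ D →
                          oppositeHyperplanes A ⊆ oppositeHyperplanes C ∪ oppositeHyperplanes D
  oppositeHyperplanes-∪ {A} {C} {D} A⊆ j∈ with ∈-select⁻ (opposite? A) j∈
  ... | x , x∈A , eq with x∈p∪q⁻ C D (A⊆ x∈A)
  ...   | inj₁ x∈C = x∈p∪q⁺ (inj₁ (∈-select⁺ (opposite? C) (x , x∈C , eq)))
  ...   | inj₂ x∈D = x∈p∪q⁺ (inj₂ (∈-select⁺ (opposite? D) (x , x∈D , eq)))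

  oppositeHyperplanes-mono : ∀ {A C} → A ⊆ C → oppositeHyperplanes A ⊆ oppositeHyperplanes C
  oppositeHyperplanes-mono {A} {C} A⊆C j∈ =
    let x , x∈A , eq = ∈-select⁻ (opposite? A) j∈ in ∈-select⁺ (opposite? C) (x , A⊆C x∈A , eq)

  -- The element `x` opposite the given hyperplane is the witness: it lies in all the others but not
  -- in this one.
  oppositeHyperplanes-irredundant : ∀ {A} → A ⊆ B →
                                    NoneContainsIntersectionOfOthers K (oppositeHyperplanes A)
  oppositeHyperplanes-irredundant {A} A⊆B i i∈ ⊆i with ∈-select⁻ (opposite? A) i∈
  ... | x , x∈A , eq = ∉-opposite (A⊆B x∈A) (subst (x ∈_) eq (⊆i (∈-intersection⁺ K x∈others)))
    where
    x∈others : ∀ {j} → j ∈ oppositeHyperplanes A Subset.- i → x ∈ hyperplane K j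
    x∈others {j} j∈ with ∈-select⁻ (opposite? A) (p─q⊆p _ _ j∈)
    ... | y , y∈A , eq′ = subst (x ∈_) (sym eq′) (∈-opposite (A⊆B x∈A) x≢y)
      where
      x≢y : x ≢ y
      x≢y refl with hyperplane-injective K {i} {j} (trans eq (sym eq′))
      ... | refl = x∉p-x _ i j∈

  module _ {I A : Subset n} (I⊆B : I ⊆ B) (A⊆B : A ⊆ B) (B⊆I∪A : B ⊆ I ∪ A)
           (I∥A : ∀ {x} → x ∈ I → x ∉ A) where

    private
      𝓗 = oppositeHyperplanes A
      F = intersection K 𝓗

    Z∪I⊆opposite : ∀ {x} → x ∈ A → Z ∪ I ⊆ opposite x
    Z∪I⊆opposite x∈A = ∪-lub (⊆-trans (⊆-∪ˡ ⊆-refl) (⊆-cl K))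
      (λ y∈I → ∈-opposite (I⊆B y∈I) (λ { refl → I∥A y∈I x∈A }))

    Z∪I⊆hyperplane : ∀ {j} → j ∈ 𝓗 → Z ∪ I ⊆ hyperplane K j
    Z∪I⊆hyperplane j∈ = let x , x∈A , eq = ∈-select⁻ (opposite? A) j∈ in
      subst (_ ∈_) (sym eq) ∘ Z∪I⊆opposite x∈A

    Z∪I⊆F : Z ∪ I ⊆ F
    Z∪I⊆F y∈ = ∈-intersection⁺ K (λ j∈ → Z∪I⊆hyperplane j∈ y∈)

    F⊆opposite : ∀ {x} → x ∈ A → F ⊆ opposite x
    F⊆opposite {x} x∈A y∈F with hyperplane-surjective K (opposite-isHyperplane (A⊆B x∈A))
    ... | j , eq = subst (_ ∈_) eq (∈-intersection⁻ K y∈F (∈-select⁺ (opposite? A) (x , x∈A , eq)))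

    -- Adding the elements of A to F one at a time raises the rank at every
    -- step, since F and the elements added before x lie in the flat opposite x.
    rank-F∪ : ∀ J → J ⊆ A → rank K F + ∣ J ∣ ≤ rank K (F ∪ J)
    rank-F∪ = subset-induction (λ J → J ⊆ A → rank K F + ∣ J ∣ ≤ rank K (F ∪ J))
      (λ _ → ≤-trans (≤-reflexive (trans (cong (rank K F +_) (∣⊥∣≡0 n)) (+-identityʳ _)))
                     (rank-⊆ K (⊆-∪ˡ ⊆-refl)))
      step
      where
      open ≤-Reasoning
      step : ∀ J x → x ∉ J → (J ⊆ A → rank K F + ∣ J ∣ ≤ rank K (F ∪ J)) →
             J ∪ ⁅ x ⁆ ⊆ A → rank K F + ∣ J ∪ ⁅ x ⁆ ∣ ≤ rank K (F ∪ (J ∪ ⁅ x ⁆))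
      step J x x∉J ih J∪x⊆A = begin
        rank K F + ∣ J ∪ ⁅ x ⁆ ∣     ≤⟨ +-monoʳ-≤ _ (∣p∪⁅x⁆∣≤1+∣p∣ J x) ⟩
        rank K F + suc ∣ J ∣         ≡⟨ +-suc _ _ ⟩
        suc (rank K F + ∣ J ∣)       ≤⟨ s≤s (ih J⊆A) ⟩
        suc (rank K (F ∪ J))         ≤⟨ rank-∪-∉flat K (cl-isFlat K _) F∪J⊆ (∉-opposite (A⊆B x∈A)) ⟩
        rank K ((F ∪ J) ∪ ⁅ x ⁆)     ≡⟨ cong (rank K) (∪-assoc F J ⁅ x ⁆) ⟩
        rank K (F ∪ (J ∪ ⁅ x ⁆))     ∎
        where
        x∈A : x ∈ A
        x∈A = J∪x⊆A (q⊆p∪q J _ (x∈⁅x⁆ x))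
        J⊆A : J ⊆ A
        J⊆A = J∪x⊆A ∘ p⊆p∪q _
        F∪J⊆ : F ∪ J ⊆ opposite x
        F∪J⊆ = ∪-lub (F⊆opposite x∈A) (λ y∈J → ∈-opposite (A⊆B (J⊆A y∈J)) (λ { refl → x∉J y∈J }))

    rank-F+∣A∣≤ : rank K F + ∣ A ∣ ≤ r K
    rank-F+∣A∣≤ = ≤-trans (rank-F∪ A ⊆-refl) (rank-⊆ K ⊆⊤)

    rank-Z∪I+∣A∣≥ : r K ≤ rank K (Z ∪ I) + ∣ A ∣
    rank-Z∪I+∣A∣≥ = ≤-trans spanning (≤-trans
      (rank-⊆ K (∪-lub (⊆-∪ˡ (⊆-∪ˡ ⊆-refl)) (⊆-trans B⊆I∪A (∪-mono (⊆-∪ʳ ⊆-refl) ⊆-refl))))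
      (rank-∪-∣∣ K (Z ∪ I) A))

    -- Adding `A` to `F` gains rank `∣ A ∣`, while adding it to the smaller set `Z ∪ I` already
    -- reaches full rank; so `F` lies in the closure of `Z ∪ I`.
    rank-F≤ : rank K F ≤ rank K (Z ∪ I)
    rank-F≤ = +-cancelʳ-≤ ∣ A ∣ _ _ (≤-trans rank-F+∣A∣≤ rank-Z∪I+∣A∣≥)

    -- The rank condition that the theorem imposes on a family, obtained by matching `𝓗` with `A` in
    -- both directions.
    rank-F+∣𝓗∣ : rank K F + ∣ 𝓗 ∣ ≡ r K
    rank-F+∣𝓗∣ = ≤-antisym
      (≤-trans (+-monoʳ-≤ _ (∣oppositeHyperplanes∣≤ A)) rank-F+∣A∣≤)
      (≤-trans rank-Z∪I+∣A∣≥ (+-mono-≤ (rank-⊆ K Z∪I⊆F) (∣∣≤oppositeHyperplanes A⊆B)))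

    F⊆hyperplane : ∀ {j} → Z ∪ I ⊆ hyperplane K j → F ⊆ hyperplane K j
    F⊆hyperplane {j} Z∪I⊆ =
      flat-⊇ K (proj₁ (hyperplane-isHyperplane K j)) Z∪I⊆ Z∪I⊆F rank-F≤

-- The rank function of the projection.

∈-hyperplanesContaining⁺ : (K : Matroid n) {X : Subset n} {j : Fin (#hyperplanes K)} →
                           X ⊆ hyperplane K j → j ∈ hyperplanesContaining K X
∈-hyperplanesContaining⁺ K {X} = ∈-select⁺ (λ i → X ⊆? hyperplane K i)

∈-hyperplanesContaining⁻ : (K : Matroid n) {X : Subset n} {j : Fin (#hyperplanes K)} →
                           j ∈ hyperplanesContaining K X → X ⊆ hyperplane K j
∈-hyperplanesContaining⁻ K {X} = ∈-select⁻ (λ i → X ⊆? hyperplane K i)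

-- The hypothesis of the theorem, named so that a module can be parametrised by it.
RespectsModularFamilies : (K : Matroid n) → Matroid (#hyperplanes K) → Set
RespectsModularFamilies K N =
  ∀ 𝓗 → NoneContainsIntersectionOfOthers K 𝓗 →
  ℤ.+ rank K (intersection K 𝓗) ≡ ℤ.+ r K ℤ.- ℤ.+ ∣ 𝓗 ∣ →
  ∀ j → intersection K 𝓗 ⊆ hyperplane K j → j ∈ cl N 𝓗

-- Translates equations between sums of naturals, in which the proof works, into the integer
-- differences of the statement.
m+n≡o⇒m≡o-n : ∀ {m n o} → m + n ≡ o → ℤ.+ m ≡ ℤ.+ o ℤ.- ℤ.+ n
m+n≡o⇒m≡o-n {m} {n} refl = sym (begin
  ℤ.+ (m + n) ℤ.- ℤ.+ n           ≡⟨ ℤ.+-assoc (ℤ.+ m) (ℤ.+ n) (ℤ.- ℤ.+ n) ⟩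
  ℤ.+ m ℤ.+ (ℤ.+ n ℤ.- ℤ.+ n)     ≡⟨ cong (ℤ._+_ (ℤ.+ m)) (ℤ.+-inverseʳ (ℤ.+ n)) ⟩
  ℤ.+ m ℤ.+ ℤ.0ℤ                  ≡⟨ ℤ.+-identityʳ (ℤ.+ m) ⟩
  ℤ.+ m                           ∎)
  where open ≡-Reasoning

+-interchange : ∀ a b c d → a + b + (c + d) ≡ a + c + (b + d)
+-interchange = solve-∀

module Projection (K : Matroid n) (N : Matroid (#hyperplanes K))
                  (respects : RespectsModularFamilies K N) where

  hyperplaneRank : Subset n → ℕ
  hyperplaneRank X = rank N (hyperplanesContaining K X)

  hyperplaneRank-antitone : ∀ {X Y} → X ⊆ Y → hyperplaneRank Y ≤ hyperplaneRank X
  hyperplaneRank-antitone X⊆Y = rank-⊆ N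
    (λ j∈ → ∈-hyperplanesContaining⁺ K (λ x∈X → ∈-hyperplanesContaining⁻ K j∈ (X⊆Y x∈X)))

  -- Hyperplanes are flats, so one that contains `X` contains everything that `X` spans.
  hyperplaneRank-spanned : ∀ {X Y} → X ⊆ Y → rank K Y ≤ rank K X → hyperplaneRank X ≤ hyperplaneRank Y
  hyperplaneRank-spanned X⊆Y rY≤rX = rank-⊆ N (λ {j} j∈ → ∈-hyperplanesContaining⁺ K
    (flat-⊇ K (proj₁ (hyperplane-isHyperplane K j)) (∈-hyperplanesContaining⁻ K j∈) X⊆Y rY≤rX))

  module Independent (Z W : Subset n) (indep : rank K Z + ∣ W ∣ ≤ rank K (Z ∪ W)) where

    private
      -- `L` completes `W` to a basis of the contraction of `Z`, so that `W ∪ L` can serve as `B`.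
      completion = augmentation K (Z ∪ W) ⊤
      L = proj₁ completion

    L∥W : ∀ {x} → x ∈ L → x ∉ W
    L∥W x∈L x∈W = proj₁ (proj₂ (proj₂ completion)) x∈L (q⊆p∪q Z _ x∈W)

    spanning : r K ≤ rank K (Z ∪ (W ∪ L))
    spanning = begin
      r K                     ≤⟨ rank-⊆ K (⊆-∪ʳ ⊆-refl) ⟩
      rank K ((Z ∪ W) ∪ ⊤)    ≤⟨ proj₁ (proj₂ (proj₂ (proj₂ completion))) ⟩
      rank K ((Z ∪ W) ∪ L)    ≡⟨ cong (rank K) (∪-assoc Z W L) ⟩
      rank K (Z ∪ (W ∪ L))    ∎
      where open ≤-Reasoning

    independent : rank K Z + ∣ W ∪ L ∣ ≤ r K
    independent = begin
      rank K Z + ∣ W ∪ L ∣         ≤⟨ +-monoʳ-≤ _ (∣p∪q∣≤∣p∣+∣q∣ W L) ⟩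
      rank K Z + (∣ W ∣ + ∣ L ∣)   ≡⟨ +-assoc (rank K Z) ∣ W ∣ ∣ L ∣ ⟨
      rank K Z + ∣ W ∣ + ∣ L ∣     ≤⟨ +-monoˡ-≤ ∣ L ∣ indep ⟩
      rank K (Z ∪ W) + ∣ L ∣       ≤⟨ proj₂ (proj₂ (proj₂ (proj₂ completion))) ⟩
      rank K ((Z ∪ W) ∪ L)         ≤⟨ rank-⊆ K ⊆⊤ ⟩
      r K                          ∎
      where open ≤-Reasoning

    open CobasisHyperplanes K Z (W ∪ L) spanning independent

    -- The hypothesis on `N` puts every hyperplane containing `Z ∪ I` in the closure of the family
    -- opposite `A`; conversely, each member of that family contains `Z ∪ I`.
    hyperplaneRank-opposite : ∀ {I A} → I ⊆ W ∪ L → A ⊆ W ∪ L → W ∪ L ⊆ I ∪ A → (∀ {x} → x ∈ I → x ∉ A) →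
                      hyperplaneRank (Z ∪ I) ≡ rank N (oppositeHyperplanes A)
    hyperplaneRank-opposite {I} {A} I⊆ A⊆ ⊆I∪A I∥A = ≤-antisym
      (rank-⊆cl N (λ {j} j∈ → respects _ (oppositeHyperplanes-irredundant A⊆)
        (m+n≡o⇒m≡o-n (rank-F+∣𝓗∣ I⊆ A⊆ ⊆I∪A I∥A)) j
        (F⊆hyperplane I⊆ A⊆ ⊆I∪A I∥A (∈-hyperplanesContaining⁻ K j∈))))
      (rank-⊆ N (λ {j} j∈ →
        ∈-hyperplanesContaining⁺ K (Z∪I⊆hyperplane I⊆ A⊆ ⊆I∪A I∥A j∈)))

    hyperplaneRank-Z : hyperplaneRank Z ≡ rank N (oppositeHyperplanes (W ∪ L))
    hyperplaneRank-Z = trans (cong hyperplaneRank (sym (∪-identityʳ Z)))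
      (hyperplaneRank-opposite ⊥⊆ ⊆-refl (⊆-∪ʳ ⊆-refl) (λ x∈⊥ → ⊥-elim (∉⊥ x∈⊥)))

    hyperplaneRank-Z∪W : hyperplaneRank (Z ∪ W) ≡ rank N (oppositeHyperplanes L)
    hyperplaneRank-Z∪W = hyperplaneRank-opposite (⊆-∪ˡ ⊆-refl) (⊆-∪ʳ ⊆-refl) ⊆-refl (λ x∈W x∈L → L∥W x∈L x∈W)

    -- The families for `Z` and `Z ∪ W` are opposite `W ∪ L` and `L`, so they differ by at most
    -- `∣ W ∣` hyperplanes.
    hyperplaneRank-drop : hyperplaneRank Z ≤ ∣ W ∣ + hyperplaneRank (Z ∪ W)
    hyperplaneRank-drop = begin
      hyperplaneRank Z                                                          ≡⟨ hyperplaneRank-Z ⟩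
      rank N (oppositeHyperplanes (W ∪ L))                              ≤⟨ rank-⊆ N (oppositeHyperplanes-∪ ⊆-refl) ⟩
      rank N (oppositeHyperplanes W ∪ oppositeHyperplanes L)            ≤⟨ rank-∪ N _ _ ⟩
      rank N (oppositeHyperplanes W) + rank N (oppositeHyperplanes L)   ≤⟨ +-mono-≤ (≤-trans (Matroid.rank-bounded N _) (∣oppositeHyperplanes∣≤ W)) (≤-reflexive (sym hyperplaneRank-Z∪W)) ⟩
      ∣ W ∣ + hyperplaneRank (Z ∪ W)                                            ∎
      where open ≤-Reasoning

    -- Complementation in `W ∪ L` turns `Z ∪ I` and `Z ∪ J` into the families opposite `J ∪ L` and
    -- `I ∪ L`. These share the family opposite `L` and jointly cover the one opposite `W ∪ L`, so
    -- submodularity of `rank N` applies.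
    hyperplaneRank-modular : ∀ {I J} → W ≡ I ∪ J → (∀ {x} → x ∈ I → x ∉ J) →
                     hyperplaneRank (Z ∪ W) + hyperplaneRank Z ≤ hyperplaneRank (Z ∪ I) + hyperplaneRank (Z ∪ J)
    hyperplaneRank-modular {I} {J} refl I∥J = begin
      hyperplaneRank (Z ∪ W) + hyperplaneRank Z
        ≡⟨ cong₂ _+_ hyperplaneRank-Z∪W hyperplaneRank-Z ⟩
      rank N (oppositeHyperplanes L) + rank N (oppositeHyperplanes (W ∪ L))
        ≡⟨ +-comm (rank N (oppositeHyperplanes L)) _ ⟩
      rank N (oppositeHyperplanes (W ∪ L)) + rank N (oppositeHyperplanes L)
        ≤⟨ rank-submodular-⊆ N (oppositeHyperplanes-mono (⊆-∪ʳ ⊆-refl)) (oppositeHyperplanes-mono (⊆-∪ʳ ⊆-refl))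
             (oppositeHyperplanes-∪ (∪-lub (∪-lub (⊆-∪ʳ (⊆-∪ˡ ⊆-refl)) (⊆-∪ˡ (⊆-∪ˡ ⊆-refl))) (⊆-∪ˡ (⊆-∪ʳ ⊆-refl)))) ⟩
      rank N (oppositeHyperplanes (J ∪ L)) + rank N (oppositeHyperplanes (I ∪ L))
        ≡⟨ cong₂ _+_
             (hyperplaneRank-opposite (⊆-∪ˡ (⊆-∪ˡ ⊆-refl)) (∪-mono (⊆-∪ʳ ⊆-refl) ⊆-refl)
               (⊆-reflexive (∪-assoc I J L))
               (λ x∈I x∈ → [ I∥J x∈I , (λ x∈L → L∥W x∈L (p⊆p∪q J x∈I)) ]′ (x∈p∪q⁻ J L x∈)))
             (hyperplaneRank-opposite (⊆-∪ˡ (⊆-∪ʳ ⊆-refl)) (∪-mono (⊆-∪ˡ ⊆-refl) ⊆-refl)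
               (∪-lub (∪-lub (⊆-∪ʳ (⊆-∪ˡ ⊆-refl)) (⊆-∪ˡ ⊆-refl)) (⊆-∪ʳ (⊆-∪ʳ ⊆-refl)))
               (λ x∈J x∈ → [ (λ x∈I → I∥J x∈I x∈J) , (λ x∈L → L∥W x∈L (q⊆p∪q I J x∈J)) ]′ (x∈p∪q⁻ I L x∈))) ⟨
      hyperplaneRank (Z ∪ I) + hyperplaneRank (Z ∪ J)
        ∎
      where open ≤-Reasoning

  total : Subset n → ℕ
  total X = rank K X + hyperplaneRank X

  -- With `I` a basis of `Y` over `X`, the rank gained in `K` is `∣ I ∣`, which bounds the loss in
  -- `hyperplaneRank`.
  total-mono : ∀ {X Y} → X ⊆ Y → total X ≤ total Y
  total-mono {X} {Y} X⊆Y with augmentation K X Y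
  ... | I , I⊆Y , _ , spans , indep = begin
    rank K X + hyperplaneRank X                     ≤⟨ +-monoʳ-≤ _ (Independent.hyperplaneRank-drop X I indep) ⟩
    rank K X + (∣ I ∣ + hyperplaneRank (X ∪ I))     ≡⟨ +-assoc (rank K X) ∣ I ∣ _ ⟨
    rank K X + ∣ I ∣ + hyperplaneRank (X ∪ I)       ≤⟨ +-mono-≤ indep (hyperplaneRank-spanned X∪I⊆Y rY≤) ⟩
    rank K (X ∪ I) + hyperplaneRank Y               ≤⟨ +-monoˡ-≤ _ (rank-⊆ K X∪I⊆Y) ⟩
    rank K Y + hyperplaneRank Y                     ∎
    where
    open ≤-Reasoning
    X∪I⊆Y : X ∪ I ⊆ Y
    X∪I⊆Y = ∪-lub X⊆Y I⊆Y
    rY≤ : rank K Y ≤ rank K (X ∪ I)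
    rY≤ = ≤-trans (rank-⊆ K (⊆-∪ʳ ⊆-refl)) spans

  total-submodular : ∀ X Y → total (X ∪ Y) + total (X ∩ Y) ≤ total X + total Y
  total-submodular X Y with augmentation K (X ∩ Y) X
  -- `J` is chosen over `(X ∩ Y) ∪ I`, which makes it disjoint from `I` and makes `I ∪ J`
  -- independent over `X ∩ Y`.
  ... | I , I⊆X , _ , spansI , indepI with augmentation K ((X ∩ Y) ∪ I) Y
  ...   | J , J⊆Y , J∥ , spansJ , indepJ = begin
    total (X ∪ Y) + total Z
      ≤⟨ +-monoˡ-≤ (total Z) (+-mono-≤ rank-X∪Y (hyperplaneRank-antitone Z∪W⊆X∪Y)) ⟩
    rank K (Z ∪ W) + hyperplaneRank (Z ∪ W) + total Z
      ≡⟨ +-interchange (rank K (Z ∪ W)) _ _ _ ⟩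
    rank K (Z ∪ W) + rank K Z + (hyperplaneRank (Z ∪ W) + hyperplaneRank Z)
      ≤⟨ +-mono-≤
           (rank-submodular-⊆ K (⊆-∪ˡ ⊆-refl) (⊆-∪ˡ ⊆-refl)
             (∪-lub (⊆-∪ˡ (⊆-∪ˡ ⊆-refl)) (∪-mono (⊆-∪ʳ ⊆-refl) (⊆-∪ʳ ⊆-refl))))
           (Independent.hyperplaneRank-modular Z W indep refl (λ x∈I x∈J → J∥ x∈J (q⊆p∪q Z I x∈I))) ⟩
    rank K (Z ∪ I) + rank K (Z ∪ J) + (hyperplaneRank (Z ∪ I) + hyperplaneRank (Z ∪ J))
      ≡⟨ +-interchange (rank K (Z ∪ I)) _ _ _ ⟩
    total (Z ∪ I) + total (Z ∪ J)
      -- `Z ∪ J` need not span `Y`, so monotonicity of the whole sum is used here.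
      ≤⟨ +-mono-≤ (total-mono Z∪I⊆X) (total-mono (∪-lub (p∩q⊆q X Y) J⊆Y)) ⟩
    total X + total Y
      ∎
    where
    open ≤-Reasoning
    Z W : Subset n
    Z = X ∩ Y
    W = I ∪ J
    Z∪I⊆X : Z ∪ I ⊆ X
    Z∪I⊆X = ∪-lub (p∩q⊆p X Y) I⊆X
    Z∪W⊆X∪Y : Z ∪ W ⊆ X ∪ Y
    Z∪W⊆X∪Y = ∪-lub (⊆-∪ˡ (p∩q⊆p X Y)) (∪-mono I⊆X J⊆Y)
    indep : rank K Z + ∣ W ∣ ≤ rank K (Z ∪ W)
    indep = begin
      rank K Z + ∣ W ∣             ≤⟨ +-monoʳ-≤ _ (∣p∪q∣≤∣p∣+∣q∣ I J) ⟩
      rank K Z + (∣ I ∣ + ∣ J ∣)   ≡⟨ +-assoc (rank K Z) ∣ I ∣ ∣ J ∣ ⟨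
      rank K Z + ∣ I ∣ + ∣ J ∣     ≤⟨ +-monoˡ-≤ ∣ J ∣ indepI ⟩
      rank K (Z ∪ I) + ∣ J ∣       ≤⟨ indepJ ⟩
      rank K ((Z ∪ I) ∪ J)         ≡⟨ cong (rank K) (∪-assoc Z I J) ⟩
      rank K (Z ∪ W)               ∎
    rank-X∪Y : rank K (X ∪ Y) ≤ rank K (Z ∪ W)
    rank-X∪Y = begin
      rank K (X ∪ Y)         ≤⟨ rank-∪-diminishing K Y Z∪I⊆X (≤-trans (rank-⊆ K (⊆-∪ʳ ⊆-refl)) spansI) ⟩
      rank K ((Z ∪ I) ∪ Y)   ≤⟨ spansJ ⟩
      rank K ((Z ∪ I) ∪ J)   ≡⟨ cong (rank K) (∪-assoc Z I J) ⟩
      rank K (Z ∪ W)         ∎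

  hyperplaneRank≤ : ∀ X → hyperplaneRank X ≤ r N
  hyperplaneRank≤ X = rank-⊆ N ⊆⊤

  -- Every hyperplane contains the empty set, so the bound holds at `⊥` and spreads by monotonicity.
  -- It makes the truncated subtraction in `projected` exact.
  r≤total : ∀ X → r N ≤ total X
  r≤total X = begin
    r N       ≤⟨ rank-⊆ N (λ _ → ∈-hyperplanesContaining⁺ K ⊥⊆) ⟩
    hyperplaneRank ⊥  ≤⟨ m≤n+m _ _ ⟩
    total ⊥   ≤⟨ total-mono ⊥⊆ ⟩
    total X   ∎
    where open ≤-Reasoning

  hyperplaneRank-⊤ : hyperplaneRank ⊤ ≡ 0
  hyperplaneRank-⊤ = n≤0⇒n≡0 (≤-trans (rank-⊆ N none) (≤-reflexive (rank-⊥ N)))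
    where
    none : hyperplanesContaining K ⊤ ⊆ ⊥
    none {j} j∈ = ⊥-elim (<⇒≱ (≤-reflexive (proj₂ (hyperplane-isHyperplane K j)))
      (rank-⊆ K (∈-hyperplanesContaining⁻ K j∈)))

  projected : Subset n → ℕ
  projected X = total X ∸ r N

  projected+r : ∀ X → projected X + r N ≡ total X
  projected+r X = m∸n+n≡m (r≤total X)

  projected≤ : ∀ X → projected X ≤ rank K X
  projected≤ X = +-cancelʳ-≤ (r N) _ _
    (≤-trans (≤-reflexive (projected+r X)) (+-monoʳ-≤ (rank K X) (hyperplaneRank≤ X)))

  projection : Matroid n
  projection = record
    { rank            = projected
    ; rank-bounded    = λ X → ≤-trans (projected≤ X) (Matroid.rank-bounded K X)
    ; rank-mono       = λ X Y X⊆Y → ∸-monoˡ-≤ (r N) (total-mono X⊆Y)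
    -- Each of the two terms on either side of the inequality for `total` carries one `r N`, hence
    -- the double cancellation.
    ; rank-submodular = λ X Y → +-cancelʳ-≤ (r N + r N) _ _
        (subst₂ _≤_ (shift (X ∪ Y) (X ∩ Y)) (shift X Y) (total-submodular X Y))
    }
    where
    shift : ∀ X Y → total X + total Y ≡ projected X + projected Y + (r N + r N)
    shift X Y = trans (sym (cong₂ _+_ (projected+r X) (projected+r Y)))
                      (+-interchange (projected X) (r N) (projected Y) (r N))

  -- The difference of the two ranks is `r N` minus the antitone `hyperplaneRank`, so it is
  -- monotone; the inequality is stated without subtraction.
  projected-quotient : ∀ {X Y} → X ⊆ Y → rank K X + projected Y ≤ rank K Y + projected X
  projected-quotient {X} {Y} X⊆Y = +-cancelʳ-≤ (r N) _ _ (begin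
    rank K X + projected Y + r N      ≡⟨ trans (+-assoc (rank K X) _ _) (cong (rank K X +_) (projected+r Y)) ⟩
    rank K X + (rank K Y + hyperplaneRank Y)  ≤⟨ +-monoʳ-≤ (rank K X) (+-monoʳ-≤ (rank K Y) (hyperplaneRank-antitone X⊆Y)) ⟩
    rank K X + (rank K Y + hyperplaneRank X)  ≡⟨ swap (rank K X) (rank K Y) (hyperplaneRank X) ⟩
    rank K Y + (rank K X + hyperplaneRank X)  ≡⟨ trans (+-assoc (rank K Y) _ _) (cong (rank K Y +_) (projected+r X)) ⟨
    rank K Y + projected X + r N      ∎)
    where
    open ≤-Reasoning
    swap : ∀ a b c → a + (b + c) ≡ b + (a + c)
    swap = solve-∀

  r-projection : r projection + r N ≡ r K
  r-projection = trans (projected+r ⊤) (trans (cong (r K +_) hyperplaneRank-⊤) (+-identityʳ (r K)))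

  projected≡rankKN : ∀ X → ℤ.+ projected X ≡ rankKN K N X
  projected≡rankKN X = trans (m+n≡o⇒m≡o-n (projected+r X)) (begin
    a ℤ.+ c ℤ.- b     ≡⟨ ℤ.+-assoc a c (ℤ.- b) ⟩
    a ℤ.+ (c ℤ.- b)   ≡⟨ cong (ℤ._+_ a) (ℤ.+-comm c (ℤ.- b)) ⟩
    a ℤ.+ (ℤ.- b ℤ.+ c) ≡⟨ ℤ.+-assoc a (ℤ.- b) c ⟨
    a ℤ.- b ℤ.+ c     ∎)
    where
    open ≡-Reasoning
    a = ℤ.+ rank K X
    b = ℤ.+ r N
    c = ℤ.+ hyperplaneRank X

-- Splitting a ground set into old and new elements.

∈-image⁺ : (e : Fin n → Fin m) {Y : Subset n} {i : Fin n} → i ∈ Y → e i ∈ image e Y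
∈-image⁺ e {Y} {i} i∈Y =
  ∈-select⁺ (λ j → Fin.any? (λ i → (i ∈? Y) ×-dec (e i Fin.≟ j))) (i , i∈Y , refl)

∈-image⁻ : (e : Fin n → Fin m) {Y : Subset n} {j : Fin m} → j ∈ image e Y → ∃[ i ] (i ∈ Y × e i ≡ j)
∈-image⁻ e {Y} = ∈-select⁻ (λ j → Fin.any? (λ i → (i ∈? Y) ×-dec (e i Fin.≟ j)))

∈-take⁺ : ∀ n {V : Subset (n + m)} {i : Fin n} → i ↑ˡ m ∈ V → i ∈ take n V
∈-take⁺ (suc n) {_ ∷ V} {zero}  here       = here
∈-take⁺ (suc n) {_ ∷ V} {suc i} (there i∈) = there (∈-take⁺ n i∈)

∈-take⁻ : ∀ n {V : Subset (n + m)} {i : Fin n} → i ∈ take n V → i ↑ˡ m ∈ V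
∈-take⁻ (suc n) {_ ∷ V} {zero}  here       = here
∈-take⁻ (suc n) {_ ∷ V} {suc i} (there i∈) = there (∈-take⁻ n i∈)

∈-drop⁺ : ∀ n {V : Subset (n + m)} {i : Fin m} → n ↑ʳ i ∈ V → i ∈ drop n V
∈-drop⁺ zero            i∈         = i∈
∈-drop⁺ (suc n) {_ ∷ V} (there i∈) = ∈-drop⁺ n i∈

∈-drop⁻ : ∀ n {V : Subset (n + m)} {i : Fin m} → i ∈ drop n V → n ↑ʳ i ∈ V
∈-drop⁻ zero            i∈ = i∈
∈-drop⁻ (suc n) {_ ∷ V} i∈ = there (∈-drop⁻ n i∈)

∣take∣+∣drop∣ : ∀ n (V : Subset (n + m)) → ∣ take n V ∣ + ∣ drop n V ∣ ≡ ∣ V ∣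
∣take∣+∣drop∣ zero    V             = refl
∣take∣+∣drop∣ (suc n) (outside ∷ V) = ∣take∣+∣drop∣ n V
∣take∣+∣drop∣ (suc n) (inside ∷ V)  = cong suc (∣take∣+∣drop∣ n V)

↑ˡ≢↑ʳ : (i : Fin n) (j : Fin m) → i ↑ˡ m ≢ n ↑ʳ j
↑ˡ≢↑ʳ (suc i) j eq = ↑ˡ≢↑ʳ i j (Fin.suc-injective eq)

∉↑ʳ⇒∈↑ˡ : ∀ n (j : Fin (n + m)) → (∀ i → n ↑ʳ i ≢ j) → ∃[ i ] i ↑ˡ m ≡ j
∉↑ʳ⇒∈↑ˡ zero    j       ≢j = contradiction refl (≢j j)
∉↑ʳ⇒∈↑ˡ (suc n) zero    ≢j = zero , refl
∉↑ʳ⇒∈↑ˡ (suc n) (suc j) ≢j =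
  let i , eq = ∉↑ʳ⇒∈↑ˡ n j (λ i eq → ≢j i (cong suc eq)) in suc i , cong suc eq

-- Constructing a lift from a monotone rank difference.

module FreeLift (K M : Matroid n) (k : ℕ) (r-difference : r M + k ≡ r K)
  (quotient : ∀ {X Y} → X ⊆ Y → rank K X + rank M Y ≤ rank K Y + rank M X) where

  -- The monotone rank difference is at most its value `k` on the whole ground set.
  rankK≤ : ∀ X → rank K X ≤ rank M X + k
  rankK≤ X = +-cancelʳ-≤ (r M) _ _ (begin
    rank K X + r M         ≤⟨ quotient ⊆⊤ ⟩
    r K + rank M X         ≡⟨ cong (_+ rank M X) r-difference ⟨
    r M + k + rank M X     ≡⟨ rotate (r M) k (rank M X) ⟩
    rank M X + k + r M     ∎)
    where
    open ≤-Reasoning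
    rotate : ∀ a b c → a + b + c ≡ c + b + a
    rotate = solve-∀

  -- The monotone rank difference is at least its value on the empty set.
  rankM≤ : ∀ X → rank M X ≤ rank K X
  rankM≤ X = begin
    rank M X              ≤⟨ m≤n+m _ _ ⟩
    rank K ⊥ + rank M X   ≤⟨ quotient ⊥⊆ ⟩
    rank K X + rank M ⊥   ≡⟨ cong (rank K X +_) (rank-⊥ M) ⟩
    rank K X + 0          ≡⟨ +-identityʳ _ ⟩
    rank K X              ∎
    where open ≤-Reasoning

  -- The first term is the rank in the direct sum of `K` with `k` coloops; the second caps it by the
  -- intended rank of `X` together with all the new elements.
  liftRank : Subset n → Subset k → ℕ
  liftRank X Z = (rank K X + ∣ Z ∣) ⊓ (rank M X + k)

  liftRank≤K : ∀ X Z → liftRank X Z ≤ rank K X + ∣ Z ∣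
  liftRank≤K X Z = m⊓n≤m _ _

  liftRank≤M : ∀ X Z → liftRank X Z ≤ rank M X + k
  liftRank≤M X Z = m⊓n≤n (rank K X + ∣ Z ∣) _

  liftRank-mono : ∀ {X Y Z W} → X ⊆ Y → Z ⊆ W → liftRank X Z ≤ liftRank Y W
  liftRank-mono X⊆Y Z⊆W = ⊓-mono-≤ (+-mono-≤ (rank-⊆ K X⊆Y) (p⊆q⇒∣p∣≤∣q∣ Z⊆W))
                                   (+-monoˡ-≤ k (rank-⊆ M X⊆Y))

  -- The union is bounded through `M` and the intersection through `K`; submodularity of `M` and the
  -- quotient inequality for `X ∩ Y ⊆ X` then combine. The cancelled summands stand in for
  -- subtraction.
  liftRank-submodular-mixed : ∀ X Y Z W →
    liftRank (X ∪ Y) (Z ∪ W) + liftRank (X ∩ Y) (Z ∩ W) ≤ rank K X + ∣ Z ∣ + (rank M Y + k)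
  liftRank-submodular-mixed X Y Z W = +-cancelʳ-≤ (rank M X + rank M (X ∩ Y)) _ _ (begin
    liftRank (X ∪ Y) (Z ∪ W) + liftRank (X ∩ Y) (Z ∩ W) + (rank M X + rank M (X ∩ Y))
      ≤⟨ +-monoˡ-≤ _ (+-mono-≤ (liftRank≤M (X ∪ Y) (Z ∪ W)) (≤-trans (liftRank≤K (X ∩ Y) (Z ∩ W)) (+-monoʳ-≤ _ (∣p∩q∣≤∣p∣ Z W)))) ⟩
    rank M (X ∪ Y) + k + (rank K (X ∩ Y) + ∣ Z ∣) + (rank M X + rank M (X ∩ Y))
      ≡⟨ split (rank M (X ∪ Y)) k (rank K (X ∩ Y)) ∣ Z ∣ (rank M X) (rank M (X ∩ Y)) ⟩
    rank M (X ∪ Y) + rank M (X ∩ Y) + (rank K (X ∩ Y) + rank M X) + (∣ Z ∣ + k)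
      ≤⟨ +-monoˡ-≤ (∣ Z ∣ + k) (+-mono-≤ (Matroid.rank-submodular M X Y) (quotient (p∩q⊆p X Y))) ⟩
    rank M X + rank M Y + (rank K X + rank M (X ∩ Y)) + (∣ Z ∣ + k)
      ≡⟨ join (rank M X) (rank M Y) (rank K X) (rank M (X ∩ Y)) ∣ Z ∣ k ⟩
    rank K X + ∣ Z ∣ + (rank M Y + k) + (rank M X + rank M (X ∩ Y))
      ∎)
    where
    open ≤-Reasoning
    split : ∀ u k a z x b → u + k + (a + z) + (x + b) ≡ u + b + (a + x) + (z + k)
    split = solve-∀
    join : ∀ x y a b z k → x + y + (a + b) + (z + k) ≡ a + z + (y + k) + (x + b)
    join = solve-∀

  -- The cases record which term attains each minimum on the right; each minimum on the left may
  -- then be bounded by whichever term suits.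
  liftRank-submodular : ∀ X Y Z W →
    liftRank (X ∪ Y) (Z ∪ W) + liftRank (X ∩ Y) (Z ∩ W) ≤ liftRank X Z + liftRank Y W
  liftRank-submodular X Y Z W
    with ⊓-sel (rank K X + ∣ Z ∣) (rank M X + k) | ⊓-sel (rank K Y + ∣ W ∣) (rank M Y + k)
  ... | inj₁ eq | inj₁ eq′ rewrite eq | eq′ = begin
    liftRank (X ∪ Y) (Z ∪ W) + liftRank (X ∩ Y) (Z ∩ W)
      ≤⟨ +-mono-≤ (liftRank≤K (X ∪ Y) (Z ∪ W)) (liftRank≤K (X ∩ Y) (Z ∩ W)) ⟩
    rank K (X ∪ Y) + ∣ Z ∪ W ∣ + (rank K (X ∩ Y) + ∣ Z ∩ W ∣)
      ≡⟨ +-interchange (rank K (X ∪ Y)) _ _ _ ⟩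
    rank K (X ∪ Y) + rank K (X ∩ Y) + (∣ Z ∪ W ∣ + ∣ Z ∩ W ∣)
      ≤⟨ +-mono-≤ (Matroid.rank-submodular K X Y) (≤-reflexive (∣p∪q∣+∣p∩q∣≡∣p∣+∣q∣ Z W)) ⟩
    rank K X + rank K Y + (∣ Z ∣ + ∣ W ∣)
      ≡⟨ +-interchange (rank K X) _ _ _ ⟩
    rank K X + ∣ Z ∣ + (rank K Y + ∣ W ∣)
      ∎
    where open ≤-Reasoning
  ... | inj₁ eq | inj₂ eq′ rewrite eq | eq′ = liftRank-submodular-mixed X Y Z W
  ... | inj₂ eq | inj₁ eq′ rewrite eq | eq′ = begin
    liftRank (X ∪ Y) (Z ∪ W) + liftRank (X ∩ Y) (Z ∩ W)
      ≡⟨ cong₂ _+_ (cong₂ liftRank (∪-comm X Y) (∪-comm Z W)) (cong₂ liftRank (∩-comm X Y) (∩-comm Z W)) ⟩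
    liftRank (Y ∪ X) (W ∪ Z) + liftRank (Y ∩ X) (W ∩ Z)
      ≤⟨ liftRank-submodular-mixed Y X W Z ⟩
    rank K Y + ∣ W ∣ + (rank M X + k)
      ≡⟨ +-comm (rank K Y + ∣ W ∣) _ ⟩
    rank M X + k + (rank K Y + ∣ W ∣)
      ∎
    where open ≤-Reasoning
  ... | inj₂ eq | inj₂ eq′ rewrite eq | eq′ = begin
    liftRank (X ∪ Y) (Z ∪ W) + liftRank (X ∩ Y) (Z ∩ W)
      ≤⟨ +-mono-≤ (liftRank≤M (X ∪ Y) (Z ∪ W)) (liftRank≤M (X ∩ Y) (Z ∩ W)) ⟩
    rank M (X ∪ Y) + k + (rank M (X ∩ Y) + k)
      ≡⟨ +-interchange (rank M (X ∪ Y)) _ _ _ ⟩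
    rank M (X ∪ Y) + rank M (X ∩ Y) + (k + k)
      ≤⟨ +-monoˡ-≤ (k + k) (Matroid.rank-submodular M X Y) ⟩
    rank M X + rank M Y + (k + k)
      ≡⟨ +-interchange (rank M X) _ _ _ ⟩
    rank M X + k + (rank M Y + k)
      ∎
    where open ≤-Reasoning

  -- By `rankK≤` the first term is the minimum, so deleting the new elements leaves `K`.
  liftRank-⊥ : ∀ X → liftRank X ⊥ ≡ rank K X
  liftRank-⊥ X = trans
    (cong (_⊓ (rank M X + k)) (trans (cong (rank K X +_) (∣⊥∣≡0 k)) (+-identityʳ _)))
    (m≤n⇒m⊓n≡m (rankK≤ X))

  -- By `rankM≤` the second term is the minimum, so contracting the new elements, of rank `k`,
  -- leaves `M`.
  liftRank-⊤ : ∀ X → liftRank X ⊤ ≡ rank M X + k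
  liftRank-⊤ X = trans
    (cong (λ c → (rank K X + c) ⊓ (rank M X + k)) (∣⊤∣≡n k))
    (m≥n⇒m⊓n≡n (+-monoˡ-≤ k (rankM≤ X)))

  P : Matroid (n + k)
  P = record
    { rank            = λ V → liftRank (take n V) (drop n V)
    ; rank-bounded    = λ V → ≤-trans (liftRank≤K (take n V) (drop n V))
        (≤-trans (+-monoˡ-≤ _ (Matroid.rank-bounded K (take n V))) (≤-reflexive (∣take∣+∣drop∣ n V)))
    ; rank-mono       = λ V V′ V⊆V′ → liftRank-mono
        (∈-take⁺ n ∘ V⊆V′ ∘ ∈-take⁻ n) (∈-drop⁺ n ∘ V⊆V′ ∘ ∈-drop⁻ n)
    ; rank-submodular = λ V V′ → subst (_≤ liftRank (take n V) (drop n V) + liftRank (take n V′) (drop n V′))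
        (sym (cong₂ _+_ (cong₂ liftRank (take-zipWith _ V V′) (drop-zipWith _ V V′))
                        (cong₂ liftRank (take-zipWith _ V V′) (drop-zipWith _ V V′))))
        (liftRank-submodular (take n V) (take n V′) (drop n V) (drop n V′))
    }

  old : Fin n → Fin (n + k)
  old = _↑ˡ k

  new : Subset (n + k)
  new = image (n ↑ʳ_) ⊤

  take-old : ∀ Y → take n (image old Y) ≡ Y
  take-old Y = ⊆-antisym
    (λ i∈ → let i′ , i′∈Y , eq = ∈-image⁻ old (∈-take⁻ n i∈) in
      subst (_∈ Y) (Fin.↑ˡ-injective k i′ _ eq) i′∈Y)
    (∈-take⁺ n ∘ ∈-image⁺ old)

  drop-old : ∀ Y → drop n (image old Y) ≡ ⊥
  drop-old Y = ⊆-antisym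
    (λ i∈ → let i′ , _ , eq = ∈-image⁻ old (∈-drop⁻ n i∈) in contradiction eq (↑ˡ≢↑ʳ i′ _))
    ⊥⊆

  take-new : take n new ≡ ⊥
  take-new = ⊆-antisym
    (λ i∈ → let i′ , _ , eq = ∈-image⁻ (n ↑ʳ_) (∈-take⁻ n i∈) in contradiction (sym eq) (↑ˡ≢↑ʳ _ i′))
    ⊥⊆

  drop-new : drop n new ≡ ⊤
  drop-new = ⊆-antisym ⊆⊤ (λ _ → ∈-drop⁺ n (∈-image⁺ (n ↑ʳ_) ∈⊤))

  labels : Labels new old
  labels = (λ {i} {j} → Fin.↑ˡ-injective k i j) , λ j → mk⇔
    (λ j∉new → ∉↑ʳ⇒∈↑ˡ n j (λ i eq → j∉new (subst (_∈ new) eq (∈-image⁺ (n ↑ʳ_) ∈⊤))))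
    (λ { (i , refl) j∈new →
      let i′ , _ , eq = ∈-image⁻ (n ↑ʳ_) j∈new in ↑ˡ≢↑ʳ i i′ (sym eq) })

  deletion : IsDeletion P old K
  deletion Y = sym (trans (cong₂ liftRank (take-old Y) (drop-old Y)) (liftRank-⊥ Y))

  rank-new : rank P new ≡ k
  rank-new = trans (cong₂ liftRank take-new drop-new)
    (trans (liftRank-⊤ ⊥) (cong (_+ k) (rank-⊥ M)))

  rank-old∪new : ∀ Y → rank P (image old Y ∪ new) ≡ rank M Y + k
  rank-old∪new Y = trans
    (cong₂ liftRank
      (trans (take-zipWith _ (image old Y) new) (trans (cong₂ _∪_ (take-old Y) take-new) (∪-identityʳ Y)))
      (trans (drop-zipWith _ (image old Y) new) (trans (cong₂ _∪_ (drop-old Y) drop-new) (∪-identityˡ ⊤))))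
    (liftRank-⊤ Y)

  contraction : IsContraction P new old M
  contraction Y = sym (trans (cong₂ _∸_ (rank-old∪new Y) rank-new) (m+n∸n≡m (rank M Y) k))

  isLift : IsLift K M
  isLift = n + k , P , new , old , labels , deletion , contraction

-- Opened only here, since a prefix + makes terms such as ∣ p ∣ + ∣ q ∣ ambiguous.
open import Data.Integer using (+_; _-_)

theorem1p8 : ∀ {n : ℕ} (K : Matroid n) (N : Matroid (#hyperplanes K)) →
    (∀ (𝓗 : Subset (#hyperplanes K)) →
    NoneContainsIntersectionOfOthers K 𝓗 →
    + rank K (intersection K 𝓗) ≡ + r K - + ∣ 𝓗 ∣ →
    ∀ j → intersection K 𝓗 ⊆ hyperplane K j → j ∈ cl N 𝓗) →
    Σ[ K-N ∈ Matroid n ]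
    (∀ X → + rank K-N X ≡ rankKN K N X) × IsRankProjection (r N) K-N K
theorem1p8 K N respects =
  projection , projected≡rankKN , isLift ,
  sym (m+n≡o⇒m≡o-n (trans (+-comm (r N) (r projection)) r-projection))
  where
  open Projection K N respects
  -- The lift uses `r N` new elements, matching the drop in rank from `K` to `projection`.
  open FreeLift K projection (r N) r-projection projected-quotient
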